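{- For any (probabilistic bounded error or deterministic) symbolic algorithm that solves $\text{Büchi}(T)$, the following lower bounds on the required number of symbolic one-step operations hold: (1) $\Omega(n)$ even for instances with constant diameter $D$; (2) $\Omega(D)$ even for instances with $|T|=1$; (3) $\Omega(|T|)$ even for instances with constant $D$; (4) $\Omega(|T|+D)$; and (5) $\Omega\big(|SCCs(G)|+\sum_{C\in SCCs(G)}D_C\big)$.
   Context: Symbolic model: the input is a finite directed graph $G=(V,E)$ (self-loops allowed), $n=|V|$, together with a starting vertex $s\in V$ and a target set $T\subseteq V$. The algorithm knows $V$, $s$, $T$, but it can access $E$ only through the one-step operations $\mathrm{Pre}(S)=\{v\in V\mid \exists s'\in S:(v,s')\in E\}$ and $\mathrm{Post}(S)=\{v\in V\mid \exists s'\in S:(s',v)\in E\}$ applied to (adaptively chosen) sets $S\subseteq V$. All other computation, in particular basic set operations on vertex sets, is unrestricted and not counted in lower bounds; any number of sets may be stored. A probabilistic bounded error algorithm may use random bits and must be correct with probability at least $2/3$ on every (admissible) input. $\text{Büchi}(T)$ (liveness): decide whether there is an infinite path in $G$ starting from $s$ that visits some vertex of $T$ infinitely often. Convention for lower bounds: a lower bound $\Omega(g)$, for a parameter $g$ of the input, means: there is an absolute constant $c>0$ such that every (deterministic or probabilistic bounded error) symbolic algorithm solving the problem performs, on inputs with arbitrarily large $g$, at least $c\cdot g$ one-step operations (worst case over its random choices). "Even for instances with property $P$" means that this already holds when the algorithm need only be correct on instances with property $P$, the hard inputs having property $P$; "constant $D$" means $D\le d_0$ for some fixed constant $d_0$.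 The diameter $D$ of $G$ is the largest finite distance: the maximum of $d(u,v)$ over all pairs $u,v$ such that $u$ can reach $v$, where $d(u,v)$ is the smallest number of edges on a path from $u$ to $v$. $SCCs(G)$ is the set of strongly connected components of $G$, and $D_C$ is the diameter of (the subgraph induced by) the component $C$. -}

module Defs where

open import Data.Bool.Base using (Bool; true; false; if_then_else_)
import Data.Bool.Properties as Bool
open import Data.Fin.Base using (Fin)
open import Data.Fin.Properties using (any?)
open import Data.Fin.Subset using (Subset; _∈_; _⊆_; Nonempty)
open import Data.Fin.Subset.Properties using (_∈?_)
open import Data.Integer.Base using (+_)
open import Data.List.Base as List using (List)
import Data.List.Membership.Propositional as List
open import Data.List.Relation.Binary.Pointwise using (Pointwise)
open import Data.List.Relation.Unary.Unique.Propositional using (Unique)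
open import Data.Maybe.Base using (Maybe; just; nothing)
import Data.Maybe.Properties as Maybe
open import Data.Nat.Base using (ℕ; zero; suc; _+_; _≤_)
open import Data.Product.Base using (Σ; ∃; ∃-syntax; _×_; _,_; proj₁; proj₂; map₂)
open import Data.Rational.Base as ℚ using (ℚ; 0ℚ; 1ℚ; ½)
open import Data.Sum.Base using (_⊎_)
open import Data.Vec.Base using (Vec; []; _∷_; tabulate)
open import Function.Base using (_on_; _∘_)
open import Function.Bundles using (_⇔_)
open import Level using (0ℓ)
open import Relation.Binary.Core using (Rel)
open import Relation.Binary.Definitions using (Decidable)
open import Relation.Binary.Construct.Closure.ReflexiveTransitive using (Star; fold)
open import Relation.Binary.PropositionalEquality.Core using (_≡_; _≢_)
open import Relation.Nullary.Decidable.Core using (does; _×-dec_)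
open import Relation.Nullary.Reflects using (Reflects)

------------------------------------------------------------------------
-- Distances

module _ {V : Set} (_⟶_ : Rel V 0ℓ) where

  length : ∀ {u v} → Star _⟶_ u v → ℕ
  length = fold (λ _ _ → ℕ) (λ _ → suc) 0

  IsDistance : V → V → ℕ → Set
  IsDistance u v d =
    (Σ (Star _⟶_ u v) λ p → length p ≡ d) ×
    ((p : Star _⟶_ u v) → d ≤ length p)

  -- Pairs (u , v) with v unreachable from u have no distance, so they do not
  -- contribute to the maximum.
  IsDiameter : ℕ → Set
  IsDiameter D =
    (∃[ u ] ∃[ v ] IsDistance u v D) ×
    (∀ u v d → IsDistance u v d → d ≤ D)

------------------------------------------------------------------------
-- Finite directed graphs

record Digraph (n : ℕ) : Set₁ where
  infix 4 _⟶_ _⟶?_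
  field
    _⟶_  : Rel (Fin n) 0ℓ
    _⟶?_ : Decidable _⟶_

module _ {n : ℕ} (G : Digraph n) where
  open Digraph G

  Pre : Subset n → Subset n
  Pre S = tabulate λ v → does (any? λ s′ → (s′ ∈? S) ×-dec (v ⟶? s′))

  Post : Subset n → Subset n
  Post S = tabulate λ v → does (any? λ s′ → (s′ ∈? S) ×-dec (s′ ⟶? v))

  -- Edges of the subgraph induced by C, whose vertex type is Σ v , v ∈ C.
  InducedEdge : (C : Subset n) → Rel (∃ (_∈ C)) 0ℓ
  InducedEdge C = _⟶_ on proj₁

  StronglyConnected : Subset n → Set
  StronglyConnected C = Nonempty C × (∀ u v → Star (InducedEdge C) u v)

  -- Single vertices count as strongly connected, with or without a self-loop,
  -- so the components partition the vertex set.
  IsSCC : Subset n → Set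
  IsSCC C =
    StronglyConnected C ×
    (∀ C′ → StronglyConnected C′ → C ⊆ C′ → C′ ⊆ C)

  IsSCCs : List (Subset n) → Set
  IsSCCs Cs = Unique Cs × (∀ C → (C List.∈ Cs) ⇔ IsSCC C)

  IsBüchi : Fin n → Subset n → Set
  IsBüchi s T =
    Σ (ℕ → Fin n) λ π →
      π 0 ≡ s ×
      (∀ i → π i ⟶ π (suc i)) ×
      (∃[ t ] t ∈ T × (∀ i → ∃[ j ] i ≤ j × π j ≡ t))

------------------------------------------------------------------------
-- Symbolic algorithms

data Action (n : ℕ) (State : Set) : Set where
  halt : Bool → Action n State
  pre  : Subset n → (Subset n → State) → Action n State
  post : Subset n → (Subset n → State) → Action n State
  toss : (Bool → State) → Action n State

-- The states are arbitrary and the transition function is an arbitrary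
-- function, so computation other than pre, post and toss is free.  Machines
-- need not terminate.
record Machine (n : ℕ) : Set₁ where
  field
    State : Set
    start : State
    next  : State → Action n State

-- What the algorithm knows at the outset: V = Fin n, s and T, but no edges.
Algorithm : Set₁
Algorithm = (n : ℕ) → Fin n → Subset n → Machine n

module _ {n : ℕ} (G : Digraph n) (M : Machine n) where
  open Machine M

  -- The first k steps of a run, k being the length of the tape of random bits:
  -- the answer, if the run has halted, and the number of one-step operations.
  -- Every step uses up one bit of the tape, but only toss reads it.
  runFrom : ∀ {k} → Action n State → Vec Bool k → Maybe Bool × ℕ
  runFrom (halt b)   _       = just b , 0
  runFrom (pre _ _)  []      = nothing , 0
  runFrom (pre S κ)  (_ ∷ ω) = map₂ suc (runFrom (next (κ (Pre G S))) ω)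
  runFrom (post _ _) []      = nothing , 0
  runFrom (post S κ) (_ ∷ ω) = map₂ suc (runFrom (next (κ (Post G S))) ω)
  runFrom (toss _)   []      = nothing , 0
  runFrom (toss κ)   (b ∷ ω) = runFrom (next (κ b)) ω

  run : ∀ {k} → Vec Bool k → Maybe Bool × ℕ
  run = runFrom (next start)

  answer : ∀ {k} → Vec Bool k → Maybe Bool
  answer = proj₁ ∘ run

  operations : ∀ {k} → Vec Bool k → ℕ
  operations = proj₂ ∘ run

-- The probability of an event over k independent fair random bits.
Pr : ∀ {k} → (Vec Bool k → Bool) → ℚ
Pr {zero}  E = if E [] then 1ℚ else 0ℚ
Pr {suc k} E = ½ ℚ.* (Pr (E ∘ (true ∷_)) ℚ.+ Pr (E ∘ (false ∷_)))

Deterministic : ∀ {n} → Machine n → Set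
Deterministic M = ∀ σ κ → next σ ≢ toss κ
  where open Machine M

------------------------------------------------------------------------
-- Solving Büchi(T)

record Input : Set₁ where
  field
    n : ℕ
    G : Digraph n
    s : Fin n
    T : Subset n

  Büchi : Set
  Büchi = IsBüchi G s T

  HasDiameter : ℕ → Set
  HasDiameter = IsDiameter (Digraph._⟶_ G)

  -- g = |SCCs(G)| + ∑ D_C, where the list Ds holds the diameters of the
  -- components listed in Cs.
  HasSCCMeasure : ℕ → Set
  HasSCCMeasure g =
    ∃[ Cs ] ∃[ Ds ]
      IsSCCs G Cs ×
      Pointwise (λ C D → IsDiameter (InducedEdge G C) D) Cs Ds ×
      g ≡ List.length Cs + List.sum Ds

open Input public using (HasDiameter; HasSCCMeasure)

module _ (A : Algorithm) (I : Input) where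
  open Input I

  machineOn : Machine n
  machineOn = A n s T

  -- The probability of having answered b within k steps increases with k, and
  -- its limit is the probability of answering b.  The bound says that this
  -- limit is at least 2/3.
  AnswersWithBoundedError : Bool → Set
  AnswersWithBoundedError b =
    ∀ q → q ℚ.< + 2 ℚ./ 3 →
    ∃[ k ] q ℚ.≤ Pr {k} λ ω →
      does (Maybe.≡-dec Bool._≟_ (answer G machineOn ω) (just b))

  AnswersSurely : Bool → Set
  AnswersSurely b = ∃[ k ] (∀ (ω : Vec Bool k) → answer G machineOn ω ≡ just b)

-- Reflects (Büchi I) b says that b is the correct answer on I.

BoundedErrorSolves : Algorithm → (Input → Set) → Set₁
BoundedErrorSolves A P =
  ∀ I → P I → ∀ b → Reflects (Input.Büchi I) b → AnswersWithBoundedError A I b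

DeterministicallySolves : Algorithm → (Input → Set) → Set₁
DeterministicallySolves A P =
  (∀ n s T → Deterministic (A n s T)) ×
  (∀ I → P I → ∀ b → Reflects (Input.Büchi I) b → AnswersSurely A I b)

SolvesBüchiOn : (Input → Set) → Algorithm → Set₁
SolvesBüchiOn P A = DeterministicallySolves A P ⊎ BoundedErrorSolves A P

------------------------------------------------------------------------
-- Lower bounds

fromℕ : ℕ → ℚ
fromℕ m = + m ℚ./ 1

-- A parameter is given by its graph: param I g says that it takes the value g
-- on I.  Algorithms need only be correct on the instances satisfying P.
record LowerBound (P : Input → Set) (param : Input → ℕ → Set) : Set₁ where
  field
    c     : ℚ
    c>0   : 0ℚ ℚ.< c
    bound : ∀ A → SolvesBüchiOn P A → ∀ N →
            Σ Input λ I → P I × ∃[ g ] param I g × N ≤ g ×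
              ∃[ k ] Σ (Vec Bool k) λ ω →
                c ℚ.* fromℕ g ℚ.≤ fromℕ (operations (Input.G I) (machineOn A I) ω)

DiameterAtMost : ℕ → Input → Set
DiameterAtMost d₀ I = ∃[ D ] HasDiameter I D × D ≤ d₀

{-# OPTIONS --safe #-}

-- Hide one bit among m in a graph whose other edges are dense enough that the
-- result of any one-step operation depends on at most one hidden bit.  On the
-- graph with no bit flipped, a run with q operations inspects at most q of the
-- m positions, and flipping any uninspected bit leaves the run unchanged while
-- it changes the correct answer.  Answering both inputs correctly within k steps
-- with probability 5/8 (less than the limit 2/3, so some finite k suffices)
-- therefore forces each position to be inspected with probability at least 1/4,
-- hence m / 4 operations on some random tape.
--
-- With edges u → v for u < v, a hidden self-loop makes a cycle: the diameter
-- is 1 and T can be all of V.  With edges u → v for v ≤ u + 1, a hidden missing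
-- edge j → j + 1 separates the last vertex from the first: the unflipped graph
-- is strongly connected with diameter n ∸ 1 and T can be the last vertex.

module Submission where

open import Algebra.Properties.CommutativeMonoid.Sum using (sum; ∑-distrib-+)
import Algebra.Properties.CommutativeSemigroup as CommutativeSemigroup
open import Data.Bool.Base using (Bool; true; false; not; if_then_else_)
import Data.Bool.Properties as Bool
import Data.Fin.Base as Fin
open import Data.Fin.Base using (Fin; zero; suc; toℕ; fromℕ<)
import Data.Fin.Properties as Fin
open import Data.Fin.Subset using (Subset; inside; outside; _∈_; ⁅_⁆; ∣_∣) renaming (⊤ to full)
import Data.Fin.Subset.Properties as Subset
import Data.Integer.Base as ℤ
import Data.Integer.Properties as ℤ
open import Data.List.Base using ([]; _∷_)
open import Data.List.Relation.Binary.Pointwise using ([]; _∷_)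
open import Data.List.Relation.Unary.All using ([])
open import Data.List.Relation.Unary.AllPairs using ([]; _∷_)
open import Data.List.Relation.Unary.Any using (here; there)
open import Data.Maybe.Base using (Maybe; just; nothing)
import Data.Maybe.Properties as Maybe
open import Data.Nat.Base
open import Data.Nat.Properties
open import Data.Product.Base using (∃; ∃-syntax; Σ; _×_; _,_; proj₁; proj₂; map₂)
import Data.Rational.Base as ℚ
open import Data.Rational.Base using (ℚ; ½; 0ℚ; 1ℚ)
import Data.Rational.Properties as ℚ
import Data.Rational.Unnormalised.Base as ℚᵘ
import Data.Rational.Unnormalised.Properties as ℚᵘ
open import Data.Sum.Base using (_⊎_; inj₁; inj₂)
open import Data.Unit.Base using (⊤; tt)
open import Data.Vec.Base using (Vec; []; _∷_; here; there)
open import Data.Vec.Properties using (tabulate-cong)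
open import Function.Base using (_∘_; id)
open import Function.Bundles using (_⇔_; mk⇔)
open import Relation.Binary.Construct.Closure.ReflexiveTransitive using (Star; ε; _◅_)
open import Relation.Binary.PropositionalEquality
open import Relation.Nullary using (¬_; yes; no; does; contradiction)
open import Relation.Nullary.Decidable using (does-⇔; dec-true; toWitness; _×-dec_; _⊎-dec_; ¬?)
open import Relation.Nullary.Reflects using (Reflects; ofʸ; ofⁿ)
open import Defs

open CommutativeSemigroup +-commutativeSemigroup using () renaming (interchange to +-interchange)

private
  ∑ : ∀ {m} → (Fin m → ℕ) → ℕ
  ∑ = sum +-0-commutativeMonoid

-- Sums over random tapes

total : ∀ {k} → (Vec Bool k → ℕ) → ℕ
total {zero}  f = f []
total {suc k} f = total (f ∘ (true ∷_)) + total (f ∘ (false ∷_))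

total-mono : ∀ {k} {f g : Vec Bool k → ℕ} → (∀ ω → f ω ≤ g ω) → total f ≤ total g
total-mono {zero}  f≤g = f≤g []
total-mono {suc k} f≤g = +-mono-≤ (total-mono (f≤g ∘ (true ∷_))) (total-mono (f≤g ∘ (false ∷_)))

total-+ : ∀ {k} (f g : Vec Bool k → ℕ) → total (λ ω → f ω + g ω) ≡ total f + total g
total-+ {zero}  f g = refl
total-+ {suc k} f g = trans
  (cong₂ _+_ (total-+ (f ∘ (true ∷_)) (g ∘ (true ∷_))) (total-+ (f ∘ (false ∷_)) (g ∘ (false ∷_))))
  (+-interchange (total (f ∘ (true ∷_))) _ _ _)

total-const : ∀ {k c} {f : Vec Bool k → ℕ} → (∀ ω → f ω ≡ c) → total f ≡ 2 ^ k * c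
total-const {zero}      f≡ = trans (f≡ []) (sym (+-identityʳ _))
total-const {suc k} {c} f≡ = trans
  (cong₂ _+_ (total-const (f≡ ∘ (true ∷_))) (total-const (f≡ ∘ (false ∷_))))
  (trans (sym (*-distribʳ-+ c (2 ^ k) (2 ^ k))) (cong (λ x → (2 ^ k + x) * c) (sym (+-identityʳ _))))

total-∑ : ∀ {k m} (f : Fin m → Vec Bool k → ℕ) →
          total (λ ω → ∑ λ j → f j ω) ≡ ∑ λ j → total (f j)
total-∑ {zero}  f = refl
total-∑ {suc k} f = trans
  (cong₂ _+_ (total-∑ λ j → f j ∘ (true ∷_)) (total-∑ λ j → f j ∘ (false ∷_)))
  (sym (∑-distrib-+ +-0-commutativeMonoid
          (λ j → total (f j ∘ (true ∷_))) (λ j → total (f j ∘ (false ∷_)))))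

-- Some value is at least the average: of the tapes found for the two halves, the one with the
-- larger value is kept. This turns a bound on the expected number of operations into a single bad
-- tape.
total≤2^k*max : ∀ {k} (f : Vec Bool k → ℕ) → ∃[ ω ] total f ≤ 2 ^ k * f ω
total≤2^k*max {zero}  f = [] , ≤-reflexive (sym (+-identityʳ (f [])))
total≤2^k*max {suc k} f = pick (total≤2^k*max (f ∘ (true ∷_))) (total≤2^k*max (f ∘ (false ∷_)))
  where
  double : ∀ {ω a b} → a ≤ 2 ^ k * f ω → b ≤ 2 ^ k * f ω → a + b ≤ 2 ^ suc k * f ω
  double {ω} {a} {b} a≤ b≤ = begin
    a + b                      ≤⟨ +-mono-≤ a≤ b≤ ⟩
    2 ^ k * f ω + 2 ^ k * f ω  ≡⟨ *-distribʳ-+ (f ω) (2 ^ k) (2 ^ k) ⟨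
    (2 ^ k + 2 ^ k) * f ω      ≡⟨ cong (λ x → (2 ^ k + x) * f ω) (+-identityʳ (2 ^ k)) ⟨
    2 ^ suc k * f ω            ∎
    where open ≤-Reasoning

  pick : (∃[ ω ] total (f ∘ (true ∷_)) ≤ 2 ^ k * f (true ∷ ω)) →
         (∃[ ω ] total (f ∘ (false ∷_)) ≤ 2 ^ k * f (false ∷ ω)) →
         ∃[ ω ] total f ≤ 2 ^ suc k * f ω
  pick (ω , p) (ω′ , p′) with ≤-total (f (true ∷ ω)) (f (false ∷ ω′))
  ... | inj₁ f≤f′ = false ∷ ω′ , double (≤-trans p (*-monoʳ-≤ (2 ^ k) f≤f′)) p′
  ... | inj₂ f′≤f = true ∷ ω   , double p (≤-trans p′ (*-monoʳ-≤ (2 ^ k) f′≤f))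

∑-lower : ∀ {m c} d {f : Fin m → ℕ} → (∀ j → c ≤ d * f j) → m * c ≤ d * ∑ f
∑-lower {zero}      d     c≤ = z≤n
∑-lower {suc m} {c} d {f} c≤ = begin
  c + m * c                       ≤⟨ +-mono-≤ (c≤ zero) (∑-lower d (c≤ ∘ suc)) ⟩
  d * f zero + d * ∑ (f ∘ suc)    ≡⟨ *-distribˡ-+ d (f zero) _ ⟨
  d * (f zero + ∑ (f ∘ suc))      ∎
  where open ≤-Reasoning

-- Rational probabilities as counts of tapes

indicator : Bool → ℕ
indicator b = if b then 1 else 0

toℚᵘ-fromℕ : ∀ a → ℚ.toℚᵘ (fromℕ a) ℚᵘ.≃ ℚᵘ.mkℚᵘ (ℤ.+ a) 0
toℚᵘ-fromℕ a = ℚ.toℚᵘ-fromℚᵘ (ℚᵘ.mkℚᵘ (ℤ.+ a) 0)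

fromℕ-+ : ∀ a b → fromℕ (a + b) ≡ fromℕ a ℚ.+ fromℕ b
fromℕ-+ a b = ℚ.toℚᵘ-injective (begin-equality
  ℚ.toℚᵘ (fromℕ (a + b))                         ≃⟨ toℚᵘ-fromℕ (a + b) ⟩
  ℚᵘ.mkℚᵘ (ℤ.+ (a + b)) 0                               ≃⟨ ℚᵘ.≃-reflexive (cong₂ (λ x y → ℚᵘ.mkℚᵘ (x ℤ.+ y) 0) (ℤ.*-identityʳ (ℤ.+ a)) (ℤ.*-identityʳ (ℤ.+ b))) ⟨
  ℚᵘ.mkℚᵘ (ℤ.+ a) 0 ℚᵘ.+ ℚᵘ.mkℚᵘ (ℤ.+ b) 0                ≃⟨ ℚᵘ.+-cong (toℚᵘ-fromℕ a) (toℚᵘ-fromℕ b) ⟨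
  ℚ.toℚᵘ (fromℕ a) ℚᵘ.+ ℚ.toℚᵘ (fromℕ b)    ≃⟨ ℚ.toℚᵘ-homo-+ (fromℕ a) (fromℕ b) ⟨
  ℚ.toℚᵘ (fromℕ a ℚ.+ fromℕ b)              ∎)
  where open ℚᵘ.≤-Reasoning

fromℕ-* : ∀ a b → fromℕ (a * b) ≡ fromℕ a ℚ.* fromℕ b
fromℕ-* a b = ℚ.toℚᵘ-injective (begin-equality
  ℚ.toℚᵘ (fromℕ (a * b))                         ≃⟨ toℚᵘ-fromℕ (a * b) ⟩
  ℚᵘ.mkℚᵘ (ℤ.+ (a * b)) 0                               ≃⟨ ℚᵘ.≃-reflexive (cong (λ x → ℚᵘ.mkℚᵘ x 0) (ℤ.pos-* a b)) ⟩
  ℚᵘ.mkℚᵘ (ℤ.+ a) 0 ℚᵘ.* ℚᵘ.mkℚᵘ (ℤ.+ b) 0                ≃⟨ ℚᵘ.*-cong (toℚᵘ-fromℕ a) (toℚᵘ-fromℕ b) ⟨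
  ℚ.toℚᵘ (fromℕ a) ℚᵘ.* ℚ.toℚᵘ (fromℕ b)    ≃⟨ ℚ.toℚᵘ-homo-* (fromℕ a) (fromℕ b) ⟨
  ℚ.toℚᵘ (fromℕ a ℚ.* fromℕ b)              ∎)
  where open ℚᵘ.≤-Reasoning

fromℕ-mono-≤ : ∀ {a b} → a ≤ b → fromℕ a ℚ.≤ fromℕ b
fromℕ-mono-≤ {a} {b} a≤b = ℚ.toℚᵘ-cancel-≤ (begin
  ℚ.toℚᵘ (fromℕ a)  ≃⟨ toℚᵘ-fromℕ a ⟩
  ℚᵘ.mkℚᵘ (ℤ.+ a) 0        ≤⟨ ℚᵘ.*≤* (ℤ.*-monoʳ-≤-nonNeg (ℤ.+ 1) (ℤ.+≤+ a≤b)) ⟩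
  ℚᵘ.mkℚᵘ (ℤ.+ b) 0        ≃⟨ toℚᵘ-fromℕ b ⟨
  ℚ.toℚᵘ (fromℕ b)  ∎)
  where open ℚᵘ.≤-Reasoning

fromℕ-cancel-≤ : ∀ {a b} → fromℕ a ℚ.≤ fromℕ b → a ≤ b
fromℕ-cancel-≤ {a} {b} a≤b =
  ℤ.drop‿+≤+ (ℤ.*-cancelʳ-≤-pos (ℤ.+ a) (ℤ.+ b) (ℤ.+ 1) (ℚᵘ.drop-*≤* (begin
    ℚᵘ.mkℚᵘ (ℤ.+ a) 0   ≃⟨ toℚᵘ-fromℕ a ⟨
    ℚ.toℚᵘ (fromℕ a)    ≤⟨ ℚ.toℚᵘ-mono-≤ a≤b ⟩
    ℚ.toℚᵘ (fromℕ b)    ≃⟨ toℚᵘ-fromℕ b ⟩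
    ℚᵘ.mkℚᵘ (ℤ.+ b) 0   ∎)))
  where open ℚᵘ.≤-Reasoning

Pr-total : ∀ {k} (E : Vec Bool k → Bool) →
           fromℕ (2 ^ k) ℚ.* Pr E ≡ fromℕ (total (indicator ∘ E))
Pr-total {zero}  E with E []
... | true  = refl
... | false = refl
Pr-total {suc k} E = begin
  fromℕ (2 * 2 ^ k) ℚ.* (½ ℚ.* (p ℚ.+ q))        ≡⟨ cong (ℚ._* (½ ℚ.* (p ℚ.+ q))) (trans (cong fromℕ (*-comm 2 (2 ^ k))) (fromℕ-* (2 ^ k) 2)) ⟩
  (N ℚ.* fromℕ 2) ℚ.* (½ ℚ.* (p ℚ.+ q))          ≡⟨ ℚ.*-assoc N (fromℕ 2) _ ⟩
  N ℚ.* (fromℕ 2 ℚ.* (½ ℚ.* (p ℚ.+ q)))          ≡⟨ cong (N ℚ.*_) (ℚ.*-assoc (fromℕ 2) ½ (p ℚ.+ q)) ⟨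
  N ℚ.* (1ℚ ℚ.* (p ℚ.+ q))                        ≡⟨ cong (N ℚ.*_) (ℚ.*-identityˡ (p ℚ.+ q)) ⟩
  N ℚ.* (p ℚ.+ q)                                 ≡⟨ ℚ.*-distribˡ-+ N p q ⟩
  N ℚ.* p ℚ.+ N ℚ.* q                             ≡⟨ cong₂ ℚ._+_ (Pr-total (E ∘ (true ∷_))) (Pr-total (E ∘ (false ∷_))) ⟩
  fromℕ (total (indicator ∘ E ∘ (true ∷_))) ℚ.+ fromℕ (total (indicator ∘ E ∘ (false ∷_)))
                                                  ≡⟨ fromℕ-+ (total (indicator ∘ E ∘ (true ∷_))) _ ⟨
  fromℕ (total (indicator ∘ E))                  ∎
  where
  open ≡-Reasoning
  N = fromℕ (2 ^ k)
  p = Pr (E ∘ (true ∷_))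
  q = Pr (E ∘ (false ∷_))

-- Two events of probability at least `⅝` overlap with probability at least 5/8 + 5/8 - 1 = 1/4. `⅛`
-- is the final constant: `m ≤ 4 * q` and `g ≤ 2 * m` give `g ≤ 8 * q`.
⅝ ⅛ : ℚ
⅝ = ℤ.+ 5 ℚ./ 8
⅛ = ℤ.+ 1 ℚ./ 8

⅝≤Pr⇒count : ∀ {k} (E : Vec Bool k → Bool) → ⅝ ℚ.≤ Pr E → 5 * 2 ^ k ≤ 8 * total (indicator ∘ E)
⅝≤Pr⇒count {k} E ⅝≤ = fromℕ-cancel-≤ (begin
  fromℕ (5 * 2 ^ k)                        ≡⟨ fromℕ-* 5 (2 ^ k) ⟩
  (fromℕ 8 ℚ.* ⅝) ℚ.* N                    ≡⟨ ℚ.*-assoc (fromℕ 8) ⅝ N ⟩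
  fromℕ 8 ℚ.* (⅝ ℚ.* N)                    ≡⟨ cong (fromℕ 8 ℚ.*_) (ℚ.*-comm ⅝ N) ⟩
  fromℕ 8 ℚ.* (N ℚ.* ⅝)                    ≤⟨ ℚ.*-monoˡ-≤-nonNeg (fromℕ 8) (ℚ.*-monoˡ-≤-nonNeg N {{N≥0}} ⅝≤) ⟩
  fromℕ 8 ℚ.* (N ℚ.* Pr E)                 ≡⟨ cong (fromℕ 8 ℚ.*_) (Pr-total E) ⟩
  fromℕ 8 ℚ.* fromℕ (total (indicator ∘ E))  ≡⟨ fromℕ-* 8 (total (indicator ∘ E)) ⟨
  fromℕ (8 * total (indicator ∘ E))        ∎)
  where
  open ℚ.≤-Reasoning
  N = fromℕ (2 ^ k)
  N≥0 : ℚ.NonNegative N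
  N≥0 = ℚ.nonNegative (fromℕ-mono-≤ {0} {2 ^ k} z≤n)

⅛*≤ : ∀ g q → g ≤ 8 * q → ⅛ ℚ.* fromℕ g ℚ.≤ fromℕ q
⅛*≤ g q g≤8q = begin
  ⅛ ℚ.* fromℕ g                    ≤⟨ ℚ.*-monoˡ-≤-nonNeg ⅛ (fromℕ-mono-≤ g≤8q) ⟩
  ⅛ ℚ.* fromℕ (8 * q)              ≡⟨ cong (⅛ ℚ.*_) (fromℕ-* 8 q) ⟩
  ⅛ ℚ.* (fromℕ 8 ℚ.* fromℕ q) ≡⟨ ℚ.*-assoc ⅛ (fromℕ 8) (fromℕ q) ⟨
  1ℚ ℚ.* fromℕ q                   ≡⟨ ℚ.*-identityˡ (fromℕ q) ⟩
  fromℕ q                          ∎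
  where open ℚ.≤-Reasoning

-- Runs on graphs that differ in one hidden bit

-- The index `i` is a natural number so that it may name no position: for `cut`, the greatest member
-- of `S` can be the last vertex, where no hidden edge starts.
RevealsOneBit : ∀ {n m} → (Fin m → Subset n → Subset n) → (Subset n → Subset n) → Set
RevealsOneBit f g = ∀ S → ∃[ i ] ∀ j → toℕ j ≢ i → f j S ≡ g S

δ : ∀ {m} → Fin m → ℕ → ℕ
δ j i = indicator (does (toℕ j ≟ i))

∑-zero : ∀ m → ∑ {m} (λ _ → 0) ≡ 0
∑-zero zero    = refl
∑-zero (suc m) = ∑-zero m

∑δ≤1 : ∀ m i → ∑ {m} (λ j → δ j i) ≤ 1
∑δ≤1 zero    i       = z≤n
∑δ≤1 (suc m) zero    = s≤s (≤-reflexive (∑-zero m))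
∑δ≤1 (suc m) (suc i) = ∑δ≤1 m i

∑δ+≤suc : ∀ {m} i (f : Fin m → ℕ) {q} → ∑ f ≤ q → ∑ (λ j → δ j i + f j) ≤ suc q
∑δ+≤suc {m} i f ∑f≤q = ≤-trans
  (≤-reflexive (∑-distrib-+ +-0-commutativeMonoid (λ j → δ j i) f))
  (+-mono-≤ (∑δ≤1 m i) ∑f≤q)

δ≡0⇒≢ : ∀ {m} (j : Fin m) i {h} → δ j i + h ≡ 0 → toℕ j ≢ i
δ≡0⇒≢ j i {h} δ≡0 refl = contradiction
  (trans (cong (λ x → indicator x + h) (sym (dec-true (toℕ j ≟ i) refl))) δ≡0) λ ()

answered : Bool → Maybe Bool → Bool
answered b r = does (Maybe.≡-dec Bool._≟_ r (just b))

-- Equal answers cannot match both `b` and `not b`, so `h ≡ 0` leaves at most one indicator set; for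
-- positive `h` the trivial bound 2 suffices. In use, `h` counts the hits on one position, `r′`
-- comes from the unflipped graph and `r` from the flipped one.
conflict : ∀ b {r r′ h} → (h ≡ 0 → r ≡ r′) →
           indicator (answered b r′) + indicator (answered (not b) r) ≤ 1 + h
conflict b {r} {r′} {zero} r≡r′ rewrite r≡r′ refl = exclusive b r′
  where
  exclusive : ∀ b r → indicator (answered b r) + indicator (answered (not b) r) ≤ 1
  exclusive true  (just true)  = ≤-refl
  exclusive true  (just false) = ≤-refl
  exclusive true  nothing      = z≤n
  exclusive false (just true)  = ≤-refl
  exclusive false (just false) = ≤-refl
  exclusive false nothing      = z≤n
conflict b {r} {r′} {suc h} _ = ≤-trans (+-mono-≤ (indicator≤1 (answered b r′)) (indicator≤1 (answered (not b) r))) (s≤s (s≤s z≤n))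
  where
  indicator≤1 : ∀ x → indicator x ≤ 1
  indicator≤1 true  = ≤-refl
  indicator≤1 false = z≤n

module _ {n : ℕ} (G : Digraph n) (M : Machine n) where
  open Machine M

  countFrom : Bool → ℕ → Action n State → ℕ
  countFrom b k a = total {k} λ ω → indicator (answered b (proj₁ (runFrom G M a ω)))

  count : Bool → ℕ → ℕ
  count b k = countFrom b k (next start)

  -- Probability at least 5/8 after `k` steps, cleared of denominators.
  Likely : Bool → ℕ → Set
  Likely b k = 5 * 2 ^ k ≤ 8 * count b k

  private
    double : ∀ x {y} → 2 * x ≤ y → 2 * (x + x) ≤ y + y
    double x 2x≤y = ≤-trans (≤-reflexive (*-distribˡ-+ 2 x x)) (+-mono-≤ 2x≤y 2x≤y)

  -- Each tape extends by one bit in two ways, and a run that has halted keeps its answer.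
  countFrom-doubles : ∀ b k a → 2 * countFrom b k a ≤ countFrom b (suc k) a
  countFrom-doubles b k       (halt _)   = ≤-reflexive (cong (total {k} _ +_) (+-identityʳ _))
  countFrom-doubles b zero    (pre _ _)  = z≤n
  countFrom-doubles b zero    (post _ _) = z≤n
  countFrom-doubles b zero    (toss _)   = z≤n
  countFrom-doubles b (suc k) (pre S κ)  =
    double (countFrom b k a) (countFrom-doubles b k a)
    where a = next (κ (Pre G S))
  countFrom-doubles b (suc k) (post S κ) =
    double (countFrom b k a) (countFrom-doubles b k a)
    where a = next (κ (Post G S))
  countFrom-doubles b (suc k) (toss κ)   =
    ≤-trans (≤-reflexive (*-distribˡ-+ 2 (total {k} _) _))
      (+-mono-≤ (countFrom-doubles b k (next (κ true))) (countFrom-doubles b k (next (κ false))))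

  Likely-suc : ∀ {b k} → Likely b k → Likely b (suc k)
  Likely-suc {b} {k} likely = begin
    5 * (2 * 2 ^ k)        ≡⟨ swap 5 (2 ^ k) ⟩
    2 * (5 * 2 ^ k)        ≤⟨ *-monoʳ-≤ 2 likely ⟩
    2 * (8 * count b k)    ≡⟨ swap 8 (count b k) ⟨
    8 * (2 * count b k)    ≤⟨ *-monoʳ-≤ 8 (countFrom-doubles b k (next start)) ⟩
    8 * count b (suc k)    ∎
    where
    open ≤-Reasoning hiding (start)
    swap : ∀ x y → x * (2 * y) ≡ 2 * (x * y)
    swap x y = trans (sym (*-assoc x 2 y)) (trans (cong (_* y) (*-comm x 2)) (*-assoc 2 x y))

  Likely-mono : ∀ {b k l} → k ≤′ l → Likely b k → Likely b l
  Likely-mono ≤′-refl               likely = likely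
  Likely-mono (≤′-step {n = l} k≤l) likely = Likely-suc {k = l} (Likely-mono k≤l likely)

-- The flipped graphs may need different numbers of steps; being finitely many, they share one tape
-- length, over which the counts can be added.
common-bound : ∀ {m} {P : Fin m → ℕ → Set} → (∀ j {k l} → k ≤ l → P j k → P j l) →
               (∀ j → ∃ (P j)) → ∃[ k ] ∀ j → P j k
common-bound {zero}  mono p = 0 , λ ()
common-bound {suc m} mono p with p zero | common-bound (mono ∘ suc) (p ∘ suc)
... | k , pk | l , pl = k ⊔ l , λ where
  zero    → mono zero (m≤m⊔n k l) pk
  (suc j) → mono (suc j) (m≤n⊔m k l) (pl j)

-- Inspected positions and the number of operations

module _ {n m : ℕ} {G : Digraph n} {H : Fin m → Digraph n}
         (pre-reveals : RevealsOneBit (Pre ∘ H) (Pre G))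
         (post-reveals : RevealsOneBit (Post ∘ H) (Post G))
         (M : Machine n) where
  open Machine M

  -- The number of operations in a run on G that reveal position j.
  hits : ∀ {k} → Fin m → Action n State → Vec Bool k → ℕ
  hits j (halt _)   _       = 0
  hits j (pre _ _)  []      = 0
  hits j (pre S κ)  (_ ∷ ω) = δ j (proj₁ (pre-reveals S)) + hits j (next (κ (Pre G S))) ω
  hits j (post _ _) []      = 0
  hits j (post S κ) (_ ∷ ω) = δ j (proj₁ (post-reveals S)) + hits j (next (κ (Post G S))) ω
  hits j (toss _)   []      = 0
  hits j (toss κ)   (b ∷ ω) = hits j (next (κ b)) ω

  -- As long as `j` is not revealed, every operation returns the same set on both graphs, so the
  -- machine passes through the same states.
  unhit⇒same-answer : ∀ {k} j a (ω : Vec Bool k) → hits j a ω ≡ 0 →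
    proj₁ (runFrom (H j) M a ω) ≡ proj₁ (runFrom G M a ω)
  unhit⇒same-answer j (halt _)   _       _ = refl
  unhit⇒same-answer j (pre _ _)  []      _ = refl
  unhit⇒same-answer j (pre S κ)  (_ ∷ ω) h
    rewrite proj₂ (pre-reveals S) j (δ≡0⇒≢ j _ h) =
    unhit⇒same-answer j (next (κ (Pre G S))) ω (m+n≡0⇒n≡0 (δ j _) h)
  unhit⇒same-answer j (post _ _) []      _ = refl
  unhit⇒same-answer j (post S κ) (_ ∷ ω) h
    rewrite proj₂ (post-reveals S) j (δ≡0⇒≢ j _ h) =
    unhit⇒same-answer j (next (κ (Post G S))) ω (m+n≡0⇒n≡0 (δ j _) h)
  unhit⇒same-answer j (toss _)   []      _ = refl
  unhit⇒same-answer j (toss κ)   (b ∷ ω) h = unhit⇒same-answer j (next (κ b)) ω h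

  -- Each operation is charged to one index, which matches at most one position.
  ∑hits≤operations : ∀ {k} a (ω : Vec Bool k) → ∑ (λ j → hits j a ω) ≤ proj₂ (runFrom G M a ω)
  ∑hits≤operations (halt _)   _       = ≤-reflexive (∑-zero m)
  ∑hits≤operations (pre _ _)  []      = ≤-reflexive (∑-zero m)
  ∑hits≤operations (pre S κ)  (_ ∷ ω) =
    ∑δ+≤suc (proj₁ (pre-reveals S)) (λ j → hits j a ω) (∑hits≤operations a ω)
    where a = next (κ (Pre G S))
  ∑hits≤operations (post _ _) []      = ≤-reflexive (∑-zero m)
  ∑hits≤operations (post S κ) (_ ∷ ω) =
    ∑δ+≤suc (proj₁ (post-reveals S)) (λ j → hits j a ω) (∑hits≤operations a ω)
    where a = next (κ (Post G S))
  ∑hits≤operations (toss _)   []      = ≤-reflexive (∑-zero m)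
  ∑hits≤operations (toss κ)   (b ∷ ω) = ∑hits≤operations (next (κ b)) ω

  -- The two counts add up to at least 5/4 of all tapes, while by `conflict` each tape contributes
  -- at most 1 plus its hits on `j`. The hits make up the missing quarter.
  position-hit-often : ∀ {b k} j → Likely G M b k → Likely (H j) M (not b) k →
    2 ^ k ≤ 4 * total {k} (hits j (next start))
  position-hit-often {b} {k} j likely likely′ =
    *-cancelˡ-≤ 2 (+-cancelˡ-≤ (8 * N) (2 * N) (2 * (4 * h)) (begin
      8 * N + 2 * N                               ≡⟨ *-distribʳ-+ N 8 2 ⟨
      10 * N                                      ≡⟨ *-distribʳ-+ N 5 5 ⟩
      5 * N + 5 * N                               ≤⟨ +-mono-≤ likely likely′ ⟩
      8 * count G M b k + 8 * count (H j) M (not b) k  ≡⟨ *-distribˡ-+ 8 (count G M b k) _ ⟨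
      8 * (count G M b k + count (H j) M (not b) k)    ≤⟨ *-monoʳ-≤ 8 counts≤ ⟩
      8 * (N + h)                                 ≡⟨ *-distribˡ-+ 8 N h ⟩
      8 * N + 8 * h                               ≡⟨ cong (8 * N +_) (*-assoc 2 4 h) ⟩
      8 * N + 2 * (4 * h)                         ∎))
    where
    open ≤-Reasoning hiding (start)
    N = 2 ^ k
    h = total {k} (hits j (next start))
    counts≤ : count G M b k + count (H j) M (not b) k ≤ N + h
    counts≤ = begin
      count G M b k + count (H j) M (not b) k  ≡⟨ total-+ {k} _ _ ⟨
      total {k} (λ ω → indicator (answered b (answer G M ω)) + indicator (answered (not b) (answer (H j) M ω)))
                                               ≤⟨ total-mono {k} (λ ω → conflict b (unhit⇒same-answer j (next start) ω)) ⟩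
      total {k} (λ ω → 1 + hits j (next start) ω) ≡⟨ total-+ {k} (λ _ → 1) _ ⟩
      total {k} (λ _ → 1) + h                  ≡⟨ cong (_+ h) (trans (total-const {k} λ _ → refl) (*-identityʳ N)) ⟩
      N + h                                    ∎

  -- Double counting of pairs of a position and a tape: every position collects at least a quarter
  -- of the tapes in hits, and on each tape all hits together are at most the operations.
  many-operations : ∀ {b} → ∃ (Likely G M b) → (∀ j → ∃ (Likely (H j) M (not b))) →
    ∃[ k ] Σ (Vec Bool k) λ ω → m ≤ 4 * operations G M ω
  many-operations {b} (k₀ , likely₀) likelies =
    k , proj₁ max , *-cancelˡ-≤ (2 ^ k) {{m^n≢0 2 k}} (begin
      2 ^ k * m                      ≡⟨ *-comm (2 ^ k) m ⟩
      m * 2 ^ k                      ≤⟨ ∑-lower 4 (λ j → position-hit-often {b} {k} j likely (likely′ j)) ⟩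
      4 * ∑ (λ j → total {k} (hits j (next start)))     ≡⟨ cong (4 *_) (total-∑ {k} (λ j → hits j (next start))) ⟨
      4 * total {k} (λ ω → ∑ (λ j → hits j (next start) ω))  ≤⟨ *-monoʳ-≤ 4 (total-mono {k} (∑hits≤operations (next start))) ⟩
      4 * total {k} (operations G M)     ≤⟨ *-monoʳ-≤ 4 (proj₂ max) ⟩
      4 * (2 ^ k * q)                ≡⟨ *-assoc 4 (2 ^ k) q ⟨
      4 * 2 ^ k * q                  ≡⟨ cong (_* q) (*-comm 4 (2 ^ k)) ⟩
      2 ^ k * 4 * q                  ≡⟨ *-assoc (2 ^ k) 4 q ⟩
      2 ^ k * (4 * q)                ∎)
    where
    open ≤-Reasoning hiding (start)
    uniform : ∃[ l ] ∀ j → Likely (H j) M (not b) l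
    uniform = common-bound (λ j k≤l → Likely-mono (H j) M (≤⇒≤′ k≤l)) likelies
    k = k₀ ⊔ proj₁ uniform
    likely : Likely G M b k
    likely = Likely-mono G M (≤⇒≤′ (m≤m⊔n k₀ _)) likely₀
    likely′ : ∀ j → Likely (H j) M (not b) k
    likely′ j = Likely-mono (H j) M (≤⇒≤′ (m≤n⊔m k₀ _)) (proj₂ uniform j)
    max = total≤2^k*max {k} (operations G M)
    q = operations G M (proj₁ max)

-- From correct algorithms on hard families to lower bounds

solves⇒Likely : ∀ {P A} → SolvesBüchiOn P A → ∀ I → P I → ∀ b → Reflects (Input.Büchi I) b →
                ∃ (Likely (Input.G I) (machineOn A I) b)
solves⇒Likely {A = A} (inj₁ (_ , sure)) I p b r = k , (begin
  -- A deterministic algorithm answers `b` on all `2 ^ k` tapes.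
  5 * 2 ^ k              ≤⟨ *-monoˡ-≤ (2 ^ k) (m≤n+m 5 3) ⟩
  8 * 2 ^ k              ≡⟨ cong (8 *_) (*-identityʳ (2 ^ k)) ⟨
  8 * (2 ^ k * 1)        ≡⟨ cong (8 *_) (total-const {k} always) ⟨
  8 * count G M b k      ∎)
  where
  open ≤-Reasoning hiding (start)
  open Input I using (G)
  M = machineOn A I
  k = proj₁ (sure I p b r)
  answered-just : ∀ b → indicator (answered b (just b)) ≡ 1
  answered-just true  = refl
  answered-just false = refl
  always : (ω : Vec Bool k) → indicator (answered b (answer G M ω)) ≡ 1
  always ω = trans (cong (indicator ∘ answered b) (proj₂ (sure I p b r) ω)) (answered-just b)
solves⇒Likely (inj₂ bounded) I p b r =
  -- Only values strictly below the limit 2/3 are guaranteed after finitely many steps; `⅝` is one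
  -- of them.
  map₂ (λ {k} → ⅝≤Pr⇒count {k} _) (bounded I p b r ⅝ (toWitness {a? = ⅝ ℚ.<? ℤ.+ 2 ℚ./ 3} tt))

-- Operations are counted on `base`, so the parameter is evaluated there only; `P` must hold on all
-- the graphs, as correctness is invoked on each. The factor 2 in `g≤2m` absorbs additive constants
-- in the parameter.
record HardFamily (P : Input → Set) (param : Input → ℕ → Set) (N : ℕ) : Set₁ where
  field
    n m    : ℕ
    s      : Fin n
    T      : Subset n
    base   : Digraph n
    flipped : Fin m → Digraph n
    b      : Bool

  input : Digraph n → Input
  input G = record { n = n ; G = G ; s = s ; T = T }

  field
    pre-reveals    : RevealsOneBit (Pre ∘ flipped) (Pre base)
    post-reveals   : RevealsOneBit (Post ∘ flipped) (Post base)
    base-answer    : Reflects (IsBüchi base s T) b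
    flipped-answer : ∀ j → Reflects (IsBüchi (flipped j) s T) (not b)
    base-P         : P (input base)
    flipped-P      : ∀ j → P (input (flipped j))
    g              : ℕ
    base-param     : param (input base) g
    N≤g            : N ≤ g
    g≤2m           : g ≤ 2 * m

hard⇒lower-bound : ∀ {P param} → (∀ N → HardFamily P param N) → LowerBound P param
hard⇒lower-bound {P} {param} family = record
  { c     = ⅛
  ; c>0   = toWitness {a? = 0ℚ ℚ.<? ⅛} tt
  ; bound = bound
  }
  where
  bound : ∀ A → SolvesBüchiOn P A → ∀ N →
          Σ Input λ I → P I × ∃[ g ] param I g × N ≤ g ×
            ∃[ k ] Σ (Vec Bool k) λ ω →
              ⅛ ℚ.* fromℕ g ℚ.≤ fromℕ (operations (Input.G I) (machineOn A I) ω)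
  bound A solves N =
    input base , base-P , g , base-param , N≤g , proj₁ hard , proj₁ (proj₂ hard) ,
    ⅛*≤ g q (≤-trans g≤2m (≤-trans (*-monoʳ-≤ 2 (proj₂ (proj₂ hard))) (≤-reflexive (sym (*-assoc 2 4 q)))))
    where
    open HardFamily (family N)
    hard : ∃[ k ] Σ (Vec Bool k) λ ω → m ≤ 4 * operations base (A n s T) ω
    hard = many-operations pre-reveals post-reveals (A n s T)
      (solves⇒Likely solves (input base) base-P b base-answer)
      (λ j → solves⇒Likely solves (input (flipped j)) (flipped-P j) (not b) (flipped-answer j))
    q = operations base (A n s T) (proj₁ (proj₂ hard))

-- Extreme members of a set and the results of one-step operations

leastMember : ∀ {n} (S : Subset n) →
              ∃[ i ] ∀ {j} → j ∈ S → toℕ j ≢ i → ∃[ x ] x ∈ S × toℕ x < toℕ j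
leastMember []            = 0 , λ ()
leastMember (inside ∷ S)  = 0 , λ where
  here      0≢0 → contradiction refl 0≢0
  (there _) _   → zero , here , z<s
leastMember (outside ∷ S) = suc (proj₁ (leastMember S)) , λ where
  (there j∈S) j≢i →
    let x , x∈S , x<j = proj₂ (leastMember S) j∈S (j≢i ∘ cong suc) in
    suc x , there x∈S , s<s x<j

-- As with `leastMember`, only members are constrained, so the index for an empty set is arbitrary:
-- 0 here, `n` there.
greatestMember : ∀ {n} (S : Subset n) →
                 ∃[ i ] ∀ {j} → j ∈ S → toℕ j ≢ i → ∃[ x ] x ∈ S × toℕ j < toℕ x
greatestMember []      = 0 , λ ()
greatestMember (b ∷ S) with Subset.nonempty? S
... | yes (y , y∈S) = suc (proj₁ (greatestMember S)) , λ where
  here        _   → suc y , there y∈S , z<s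
  (there j∈S) j≢i →
    let x , x∈S , j<x = proj₂ (greatestMember S) j∈S (j≢i ∘ cong suc) in
    suc x , there x∈S , s<s j<x
-- With an empty tail, 0 is the only possible member.
... | no empty = 0 , λ where
  here        0≢0 → contradiction refl 0≢0
  (there j∈S) _   → contradiction (_ , j∈S) empty

module _ {n m : ℕ} (G : Digraph n) (H : Fin m → Digraph n) where

  pre-revealsOneBit :
    (∀ S → ∃[ i ] ∀ j → toℕ j ≢ i → ∀ v →
      (∃[ s ] s ∈ S × Digraph._⟶_ (H j) v s) ⇔ (∃[ s ] s ∈ S × Digraph._⟶_ G v s)) →
    RevealsOneBit (Pre ∘ H) (Pre G)
  pre-revealsOneBit reveals S = map₂
    (λ same j j≢i → tabulate-cong λ v → does-⇔ (same j j≢i v)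
      (Fin.any? λ s → (s Subset.∈? S) ×-dec Digraph._⟶?_ (H j) v s)
      (Fin.any? λ s → (s Subset.∈? S) ×-dec Digraph._⟶?_ G v s))
    (reveals S)

  post-revealsOneBit :
    (∀ S → ∃[ i ] ∀ j → toℕ j ≢ i → ∀ v →
      (∃[ s ] s ∈ S × Digraph._⟶_ (H j) s v) ⇔ (∃[ s ] s ∈ S × Digraph._⟶_ G s v)) →
    RevealsOneBit (Post ∘ H) (Post G)
  post-revealsOneBit reveals S = map₂
    (λ same j j≢i → tabulate-cong λ v → does-⇔ (same j j≢i v)
      (Fin.any? λ s → (s Subset.∈? S) ×-dec Digraph._⟶?_ (H j) s v)
      (Fin.any? λ s → (s Subset.∈? S) ×-dec Digraph._⟶?_ G s v))
    (reveals S)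

-- Hidden self-loops

module _ (n : ℕ) where

  ascending : Digraph n
  ascending = record { _⟶_ = Fin._<_ ; _⟶?_ = Fin._<?_ }

  looped : Fin n → Digraph n
  looped j = record
    { _⟶_  = λ u v → u Fin.< v ⊎ (u ≡ j × v ≡ j)
    ; _⟶?_ = λ u v → (u Fin.<? v) ⊎-dec ((u Fin.≟ j) ×-dec (v Fin.≟ j))
    }

  -- The loop can only add `j` itself, and only if `j ∈ S`. Any larger member of `S` already puts
  -- `j` into `Pre`, so only the greatest member is revealed.
  looped-pre-reveals : RevealsOneBit (Pre ∘ looped) (Pre ascending)
  looped-pre-reveals = pre-revealsOneBit ascending looped λ S →
    map₂ (λ beyond j j≢i v → mk⇔
      (λ where
        (s , s∈S , inj₁ v<s)           → s , s∈S , v<s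
        (_ , j∈S , inj₂ (refl , refl)) → beyond j∈S j≢i)
      (map₂ (map₂ inj₁)))
    (greatestMember S)

  -- Dually, a smaller member of `S` already puts `j` into `Post`.
  looped-post-reveals : RevealsOneBit (Post ∘ looped) (Post ascending)
  looped-post-reveals = post-revealsOneBit ascending looped λ S →
    map₂ (λ below j j≢i v → mk⇔
      (λ where
        (s , s∈S , inj₁ s<v)           → s , s∈S , s<v
        (_ , j∈S , inj₂ (refl , refl)) → below j∈S j≢i)
      (map₂ (map₂ inj₁)))
    (leastMember S)

  -- There is no infinite path at all: labels strictly increase, so `π n` would be at least `n`.
  ascending-not-Büchi : ∀ s T → ¬ IsBüchi ascending s T
  ascending-not-Büchi s T (π , _ , step , _) = <-irrefl refl (≤-<-trans (climbs n) (Fin.toℕ<n (π n)))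
    where
    climbs : ∀ i → i ≤ toℕ (π i)
    climbs zero    = z≤n
    climbs (suc i) = ≤-<-trans (climbs i) (step i)

looped-Büchi : ∀ {n} (j : Fin (suc n)) → IsBüchi (looped (suc n) j) zero full
looped-Büchi j = π , refl , step , j , Subset.∈⊤ , λ i → suc i , n≤1+n i , refl
  where
  π : ℕ → Fin _
  π zero    = zero
  π (suc _) = j
  step : ∀ i → Digraph._⟶_ (looped _ j) (π i) (π (suc i))
  step (suc i) = inj₂ (refl , refl)
  -- The first step is the loop itself if `j` is `zero`, and an ascending edge otherwise.
  step zero    = from-zero j
    where
    from-zero : ∀ i → Digraph._⟶_ (looped _ i) zero i
    from-zero zero    = inj₂ (refl , refl)
    from-zero (suc _) = inj₁ z<s

-- Reachable vertices are equal or joined by a direct ascending edge. Two vertices are required for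
-- distance 1 to occur.
diameter-1 : ∀ {N} {_⟶_ : Fin (2 + N) → Fin (2 + N) → Set} →
             (∀ {u v} → u Fin.< v → u ⟶ v) → (∀ {u v} → u ⟶ v → u Fin.≤ v) →
             IsDiameter _⟶_ 1
diameter-1 {N} {_⟶_} <⇒⟶ ⟶⇒≤ =
  (zero , suc zero , (<⇒⟶ z<s ◅ ε , refl) , λ { (_ ◅ _) → s≤s z≤n }) ,
  λ { u v d ((p , refl) , d≤) → shortcut p d≤ }
  where
  monotone : ∀ {u v} → Star _⟶_ u v → u Fin.≤ v
  monotone ε       = ≤-refl
  monotone (e ◅ p) = ≤-trans (⟶⇒≤ e) (monotone p)
  shortcut : ∀ {u v d} → Star _⟶_ u v → ((p : Star _⟶_ u v) → d ≤ length _⟶_ p) → d ≤ 1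
  shortcut {u} {v} p d≤ with m≤n⇒m<n∨m≡n (monotone p)
  ... | inj₁ u<v = d≤ (<⇒⟶ u<v ◅ ε)
  ... | inj₂ u≡v with refl ← Fin.toℕ-injective u≡v = m≤n⇒m≤1+n (d≤ ε)

-- With `T = full` the size of `T` equals the number of vertices, so one family serves both
-- parameters.
loopFamily : ∀ {param} →
             (∀ n (G : Digraph (suc n)) → param (record { n = suc n ; G = G ; s = zero ; T = full }) (suc n)) →
             ∀ N → HardFamily (DiameterAtMost 1) param N
loopFamily param N = record
  { n = n ; m = n ; s = zero ; T = full
  ; base = ascending n ; flipped = looped n ; b = false
  ; pre-reveals    = looped-pre-reveals n
  ; post-reveals   = looped-post-reveals n
  ; base-answer    = ofⁿ (ascending-not-Büchi n zero full)
  ; flipped-answer = λ j → ofʸ (looped-Büchi j)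
  ; base-P         = 1 , diameter-1 id <⇒≤ , ≤-refl
  ; flipped-P      = λ j → 1 , diameter-1 inj₁ (λ where
      (inj₁ u<v)           → <⇒≤ u<v
      (inj₂ (refl , refl)) → ≤-refl) , ≤-refl
  ; g              = n
  ; base-param     = param (suc N) (ascending n)
  ; N≤g            = m≤n+m N 2
  ; g≤2m           = m≤n*m n 2
  }
  where n = 2 + N

-- Hidden missing edges

climbing : ∀ n → Digraph n
climbing n = record
  { _⟶_  = λ u v → toℕ v ≤ suc (toℕ u)
  ; _⟶?_ = λ u v → toℕ v ≤? suc (toℕ u)
  }

module _ {m : ℕ} where

  cut : Fin m → Digraph (suc m)
  cut j = record
    { _⟶_  = λ u v → toℕ v ≤ suc (toℕ u) × ¬ (toℕ u ≡ toℕ j × toℕ v ≡ suc (toℕ j))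
    ; _⟶?_ = λ u v → (toℕ v ≤? suc (toℕ u)) ×-dec ¬? ((toℕ u ≟ toℕ j) ×-dec (toℕ v ≟ suc (toℕ j)))
    }

  -- Only `j` can drop out of `Pre S`, having lost its edge to `j + 1`. A member of `S` below
  -- `j + 1` still receives an edge from `j`, so this requires `j + 1` to be the least member.
  cut-pre-reveals : RevealsOneBit (Pre ∘ cut) (Pre (climbing (suc m)))
  cut-pre-reveals = pre-revealsOneBit (climbing (suc m)) cut λ S →
    -- A position is the tail of its edge, one below the head. If the least member is 0, `pred`
    -- yields position 0, which is merely exempted.
    pred (proj₁ (leastMember S)) , λ j j≢i v → mk⇔ (map₂ (map₂ proj₁)) (detour S j j≢i v)
    where
    detour : ∀ S j → toℕ j ≢ pred (proj₁ (leastMember S)) → ∀ v →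
             (∃[ s ] s ∈ S × toℕ s ≤ suc (toℕ v)) → ∃[ s ] s ∈ S × Digraph._⟶_ (cut j) v s
    detour S j j≢i v (s , s∈S , s≤1+v) with (toℕ v ≟ toℕ j) ×-dec (toℕ s ≟ suc (toℕ j))
    ... | no other = s , s∈S , s≤1+v , other
    ... | yes (v≡j , s≡1+j) =
      let x , x∈S , x<s = proj₂ (leastMember S) s∈S (λ s≡i → j≢i (cong pred (trans (sym s≡1+j) s≡i))) in
      x , x∈S , ≤-trans (<⇒≤ x<s) s≤1+v , λ (_ , x≡1+j) → <-irrefl (trans x≡1+j (sym s≡1+j)) x<s

  -- Only `j + 1` can drop out of `Post S`. A member of `S` above `j` reaches it by a loop or a
  -- descending edge, so this requires `j` to be the greatest member.
  cut-post-reveals : RevealsOneBit (Post ∘ cut) (Post (climbing (suc m)))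
  cut-post-reveals = post-revealsOneBit (climbing (suc m)) cut λ S →
    proj₁ (greatestMember S) , λ j j≢i v → mk⇔ (map₂ (map₂ proj₁)) (detour S j j≢i v)
    where
    detour : ∀ S j → toℕ j ≢ proj₁ (greatestMember S) → ∀ v →
             (∃[ s ] s ∈ S × toℕ v ≤ suc (toℕ s)) → ∃[ s ] s ∈ S × Digraph._⟶_ (cut j) s v
    detour S j j≢i v (s , s∈S , v≤1+s) with (toℕ s ≟ toℕ j) ×-dec (toℕ v ≟ suc (toℕ j))
    ... | no other = s , s∈S , v≤1+s , other
    ... | yes (s≡j , v≡1+j) =
      let x , x∈S , s<x = proj₂ (greatestMember S) s∈S (λ s≡i → j≢i (trans (sym s≡j) s≡i)) in
      x , x∈S , ≤-trans v≤1+s (m≤n⇒m≤1+n s<x) , λ (x≡j , _) → <-irrefl (trans s≡j (sym x≡j)) s<x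

  cut-not-Büchi : ∀ j → ¬ IsBüchi (cut j) zero ⁅ Fin.fromℕ m ⁆
  cut-not-Büchi j (π , π0 , step , t , t∈T , visits) with refl ← Subset.x∈⁅y⁆⇒x≡y _ t∈T =
    let k , _ , πk≡last = visits 0 in
    <-irrefl refl (<-≤-trans (Fin.toℕ<n j)
      (subst (_≤ toℕ j) (trans (cong toℕ πk≡last) (Fin.toℕ-fromℕ m)) (stuck k)))
    where
    -- The only edge leaving the vertices up to `j` was the one removed.
    stuck : ∀ i → toℕ (π i) ≤ toℕ j
    stuck zero    = ≤-trans (≤-reflexive (cong toℕ π0)) z≤n
    stuck (suc i) with step i | m≤n⇒m<n∨m≡n (stuck i)
    ... | up , _    | inj₁ π<j = ≤-trans up π<j
    ... | up , ¬cut | inj₂ π≡j = s≤s⁻¹ (≤∧≢⇒< (≤-trans up (s≤s (stuck i))) λ π′≡1+j → ¬cut (π≡j , π′≡1+j))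

climbing-Büchi : ∀ m → IsBüchi (climbing (suc m)) zero ⁅ Fin.fromℕ m ⁆
climbing-Büchi m = π , Fin.toℕ-injective (toℕ-π 0) , step , Fin.fromℕ m , Subset.x∈⁅x⁆ _ ,
  λ i → i ⊔ m , m≤m⊔n i m ,
    Fin.toℕ-injective (trans (toℕ-π (i ⊔ m)) (trans (m≥n⇒m⊓n≡n (m≤n⊔m i m)) (sym (Fin.toℕ-fromℕ m))))
  where
  π : ℕ → Fin (suc m)
  -- The path climbs one vertex at a time and then stays at the last one, using its self-loop.
  π i = fromℕ< (s≤s (m⊓n≤n i m))
  toℕ-π : ∀ i → toℕ (π i) ≡ i ⊓ m
  toℕ-π i = Fin.toℕ-fromℕ< (s≤s (m⊓n≤n i m))
  step : ∀ i → toℕ (π (suc i)) ≤ suc (toℕ (π i))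
  step i = subst₂ (λ x y → x ≤ suc y) (sym (toℕ-π (suc i))) (sym (toℕ-π i))
    (⊓-monoʳ-≤ (suc i) (n≤1+n m))

-- The vertex type is abstract so that the results apply both to the whole graph and to the subgraph
-- induced by `full`, whose vertices carry membership proofs.
module _ {m : ℕ} {V : Set} (toFin : V → Fin (2 + m)) (fromFin : Fin (2 + m) → V)
         (toFin-fromFin : ∀ i → toFin (fromFin i) ≡ i) where

  private
    height : V → ℕ
    height = toℕ ∘ toFin

    _⟶_ : V → V → Set
    u ⟶ v = height v ≤ suc (height u)

    height-fromFin : ∀ i → height (fromFin i) ≡ toℕ i
    height-fromFin i = cong toℕ (toFin-fromFin i)

    -- The path rises by one height at a time until a single edge reaches `v`. The last edge is
    -- always taken, even for `u` equal to `v`, hence the bound `suc k`.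
    climb : ∀ k u v → height v ≤ suc k + height u → Σ (Star _⟶_ u v) λ p → length _⟶_ p ≤ suc k
    climb zero    u v v≤ = v≤ ◅ ε , ≤-refl
    climb (suc k) u v v≤ with height v ≤? suc (height u)
    ... | yes v≤1+u = v≤1+u ◅ ε , s≤s z≤n
    ... | no  v≰1+u =
      let p , p≤ = climb k w v (≤-trans v≤ (≤-reflexive (trans (cong suc (sym (+-suc k _))) (cong (suc k +_) (sym w≡))))) in
      ≤-reflexive w≡ ◅ p , s≤s p≤
      where
      1+u<n = <-trans (≰⇒> v≰1+u) (Fin.toℕ<n (toFin v))
      w = fromFin (fromℕ< 1+u<n)
      w≡ : height w ≡ suc (height u)
      w≡ = trans (height-fromFin _) (Fin.toℕ-fromℕ< 1+u<n)

    path : ∀ u v → Σ (Star _⟶_ u v) λ p → length _⟶_ p ≤ suc m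
    path u v = climb m u v (≤-trans (s≤s⁻¹ (Fin.toℕ<n (toFin v))) (m≤m+n (suc m) (height u)))

    -- An edge gains at most one unit of height; this gives the lower bound on the distance from
    -- bottom to top.
    rise : ∀ {u v} (p : Star _⟶_ u v) → height v ≤ length _⟶_ p + height u
    rise ε               = ≤-refl
    rise {u} (_◅_ {j = w} e p) = ≤-trans (rise p)
      (≤-trans (+-monoʳ-≤ (length _⟶_ p) e) (≤-reflexive (+-suc (length _⟶_ p) (height u))))

  climbing-connected : ∀ u v → Star _⟶_ u v
  climbing-connected u v = proj₁ (path u v)

  climbing-diameter : IsDiameter _⟶_ (suc m)
  climbing-diameter =
    (bottom , top , (proj₁ (path bottom top) , ≤-antisym (proj₂ (path bottom top)) (far (proj₁ (path bottom top)))) , far) ,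
    λ u v d (_ , d≤) → ≤-trans (d≤ (proj₁ (path u v))) (proj₂ (path u v))
    where
    bottom = fromFin zero
    top = fromFin (Fin.fromℕ (suc m))
    far : (p : Star _⟶_ bottom top) → suc m ≤ length _⟶_ p
    far p = subst₂ _≤_ (trans (height-fromFin _) (Fin.toℕ-fromℕ (suc m)))
      (trans (cong (length _⟶_ p +_) (height-fromFin zero)) (+-identityʳ _)) (rise p)

climbing-SCCs : ∀ m → IsSCCs (climbing (2 + m)) (full ∷ [])
climbing-SCCs m = ([] ∷ []) , λ C → mk⇔
  (λ { (here refl) → full-connected , λ _ _ _ _ → Subset.∈⊤ })
  -- Since `full` is strongly connected, maximality makes every component contain it.
  (λ (_ , maximal) → here (Subset.⊆-antisym Subset.⊆⊤ (maximal full full-connected Subset.⊆⊤)))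
  where
  full-connected : StronglyConnected (climbing (2 + m)) full
  full-connected = (zero , Subset.∈⊤) , climbing-connected proj₁ (_, Subset.∈⊤) λ _ → refl

-- `h m` is the parameter on the uncut graph with `suc m` vertices: `id` for the diameter, `suc`
-- both for the diameter plus a single target and for the diameter plus a single component.
cutFamily : ∀ {P param} (h : ℕ → ℕ) →
  (∀ m G → P (record { n = suc m ; G = G ; s = zero ; T = ⁅ Fin.fromℕ m ⁆ })) →
  (∀ m → param (record { n = 2 + m ; G = climbing (2 + m) ; s = zero ; T = ⁅ Fin.fromℕ (suc m) ⁆ }) (h (suc m))) →
  (∀ m → m ≤ h m) → (∀ m → h (suc m) ≤ 2 * suc m) →
  ∀ N → HardFamily P param N
cutFamily h P param m≤h h≤2m N = record
  { n = suc m ; m = m ; s = zero ; T = ⁅ Fin.fromℕ m ⁆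
  ; base = climbing (suc m) ; flipped = cut ; b = true
  ; pre-reveals    = cut-pre-reveals
  ; post-reveals   = cut-post-reveals
  ; base-answer    = ofʸ (climbing-Büchi m)
  ; flipped-answer = λ j → ofⁿ (cut-not-Büchi j)
  ; base-P         = P m (climbing (suc m))
  ; flipped-P      = λ j → P m (cut j)
  ; g              = h m
  ; base-param     = param N
  ; N≤g            = ≤-trans (n≤1+n N) (m≤h m)
  ; g≤2m           = h≤2m N
  }
  -- The successor supplies the two vertices that `climbing-diameter` presupposes.
  where m = suc N

theorem3p10 :
  (∃[ d₀ ] LowerBound (DiameterAtMost d₀) (λ I g → g ≡ Input.n I)) ×
  LowerBound (λ I → ∣ Input.T I ∣ ≡ 1) HasDiameter ×
  (∃[ d₀ ] LowerBound (DiameterAtMost d₀) (λ I g → g ≡ ∣ Input.T I ∣)) ×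
  LowerBound (λ _ → ⊤) (λ I g → ∃[ D ] HasDiameter I D × g ≡ ∣ Input.T I ∣ + D) ×
  LowerBound (λ _ → ⊤) HasSCCMeasure
theorem3p10 =
  (1 , hard⇒lower-bound (loopFamily λ _ _ → refl)) ,
  hard⇒lower-bound (cutFamily id (λ m _ → Subset.∣⁅x⁆∣≡1 (Fin.fromℕ m)) diameter
    (λ _ → ≤-refl) (λ m → m≤n*m (suc m) 2)) ,
  (1 , hard⇒lower-bound (loopFamily λ n _ → sym (Subset.∣⊤∣≡n (suc n)))) ,
  hard⇒lower-bound (cutFamily suc (λ _ _ → tt)
    (λ m → suc m , diameter m , cong (_+ suc m) (sym (Subset.∣⁅x⁆∣≡1 (Fin.fromℕ (suc m)))))
    n≤1+n 1+m≤2m) ,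
  hard⇒lower-bound (cutFamily suc (λ _ _ → tt)
    (λ m → full ∷ [] , suc m ∷ [] , climbing-SCCs m ,
      climbing-diameter proj₁ (_, Subset.∈⊤) (λ _ → refl) ∷ [] ,
      cong suc (sym (+-identityʳ (suc m))))
    n≤1+n 1+m≤2m)
  where
  diameter : ∀ m → IsDiameter (Digraph._⟶_ (climbing (2 + m))) (suc m)
  diameter m = climbing-diameter id id λ _ → refl
  1+m≤2m : ∀ m → 2 + m ≤ 2 * suc m
  1+m≤2m m = s≤s (≤-trans (s≤s (m≤m+n m 0)) (m≤n+m (suc (m + 0)) m))
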